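{- There is a semi-decidable FC equivalence relation $E$ on $\mathbb{N}$ such that (a) there do not exist $n>1$ and decidable equivalence relations $H_1,\dots,H_n$ on $\mathbb{N}$ that satisfy $E=\bigvee_{i\le n} H_i$, and (b) there do not exist $n>1$ and decidable equivalence relations $H_1,\dots,H_n$ on $\mathbb{N}$ (not necessarily distinct) such that $E=H_1\cdots H_n$.
   Context: $\mathbb{N}=\{0,1,2,\dots\}$. Relations are subsets of $\mathbb{N}\times\mathbb{N}$. "Decidable" means recursive; "semi-decidable" means recursively enumerable. An equivalence relation on $\mathbb{N}$ is called FC if every one of its equivalence classes is finite. The composition of binary relations is $RS=\{(x,z) : \exists y\, [(x,y)\in R \text{ and } (y,z)\in S]\}$, and $H_1\cdots H_n$ is the iterated composition. $\bigvee_{i\le n}H_i$ denotes the join in the lattice of equivalence relations, i.e. the transitive closure of $H_1\cup\dots\cup H_n$. -}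

module Defs where

open import Data.Fin.Base using (Fin)
open import Data.List.Base using (List)
open import Data.List.Membership.Propositional using (_∈_)
open import Data.Nat.Base using (ℕ; zero; suc; _<_)
open import Data.Product.Base using (Σ-syntax; ∃-syntax; _×_)
open import Data.Vec.Base using (Vec; []; _∷_; lookup)
open import Data.Vec.Functional using (Vector; foldr)
open import Data.Vec.Relation.Binary.Pointwise.Inductive using (Pointwise)
open import Function.Bundles using () renaming (_⇔_ to _⇔ₚ_)
open import Level using (0ℓ)
open import Relation.Binary.Construct.Closure.Transitive using (TransClosure)
open import Relation.Binary.Construct.Composition using (_;_)
open import Relation.Binary.Core using (Rel)
open import Relation.Binary.PropositionalEquality.Core using (_≡_)
open import Relation.Nullary.Negation.Core using (¬_)

-- Programs for the partial recursive (Kleene μ-recursive) functions ℕⁿ ⇀ ℕ.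
data PartialRecursive : ℕ → Set where
  zeroᶠ : ∀ {n} → PartialRecursive n
  sucᶠ  : PartialRecursive 1
  proj  : ∀ {n} → Fin n → PartialRecursive n
  comp  : ∀ {m n} → PartialRecursive m → Vec (PartialRecursive n) m →
          PartialRecursive n
  rec   : ∀ {n} → PartialRecursive n → PartialRecursive (suc (suc n)) →
          PartialRecursive (suc n)
  μ     : ∀ {n} → PartialRecursive (suc n) → PartialRecursive n

infix 4 _[_]↓_

-- f [ xs ]↓ v : the function computed by f is defined at xs, with value v.
data _[_]↓_ : ∀ {n} → PartialRecursive n → Vec ℕ n → ℕ → Set where
  zero↓ : ∀ {n} {xs : Vec ℕ n} → zeroᶠ [ xs ]↓ 0
  suc↓  : ∀ {x} → sucᶠ [ x ∷ [] ]↓ suc x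
  proj↓ : ∀ {n} {xs : Vec ℕ n} (i : Fin n) → proj i [ xs ]↓ lookup xs i
  comp↓ : ∀ {m n} {f : PartialRecursive m} {gs : Vec (PartialRecursive n) m}
            {xs : Vec ℕ n} {vs : Vec ℕ m} {v} →
          Pointwise (λ g w → g [ xs ]↓ w) gs vs →
          f [ vs ]↓ v →
          comp f gs [ xs ]↓ v
  rec-zero↓ : ∀ {n} {f : PartialRecursive n} {g : PartialRecursive (suc (suc n))}
                {xs : Vec ℕ n} {v} →
              f [ xs ]↓ v →
              rec f g [ zero ∷ xs ]↓ v
  rec-suc↓  : ∀ {n} {f : PartialRecursive n} {g : PartialRecursive (suc (suc n))}
                {xs : Vec ℕ n} {k w v} →
              rec f g [ k ∷ xs ]↓ w →
              g [ k ∷ w ∷ xs ]↓ v →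
              rec f g [ suc k ∷ xs ]↓ v
  μ↓    : ∀ {n} {f : PartialRecursive (suc n)} {xs : Vec ℕ n} {v} →
          (∀ k → k < v → ∃[ w ] f [ k ∷ xs ]↓ suc w) →
          f [ v ∷ xs ]↓ 0 →
          μ f [ xs ]↓ v

-- The characteristic function of R is recursive. Constructively this is weaker
-- than asking for a χ with a proof, at each (x , y), that one of the two cases
-- holds; classically the two agree, and χ is total.
Recursive : Rel ℕ 0ℓ → Set
Recursive R = Σ[ χ ∈ PartialRecursive 2 ]
  (∀ x y → (R x y → χ [ x ∷ y ∷ [] ]↓ 1) × (¬ R x y → χ [ x ∷ y ∷ [] ]↓ 0))

-- R is the domain of a partial recursive function.
RecursivelyEnumerable : Rel ℕ 0ℓ → Set
RecursivelyEnumerable R = Σ[ f ∈ PartialRecursive 2 ]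
  (∀ x y → R x y ⇔ₚ (∃[ v ] f [ x ∷ y ∷ [] ]↓ v))

-- Finiteness of a class means that some list contains all its elements. Listing
-- exactly its elements is classically equivalent, but constructively would make
-- membership in the class decidable.
FC : Rel ℕ 0ℓ → Set
FC E = ∀ x → Σ[ ys ∈ List ℕ ] (∀ y → E x y → y ∈ ys)

⋁ : ∀ {n} → Vector (Rel ℕ 0ℓ) n → Rel ℕ 0ℓ
⋁ H = TransClosure (λ x y → ∃[ i ] H i x y)

-- H₁ ; (H₂ ; (⋯ ; (Hₙ ; _≡_))), where the final factor _≡_ is the empty composition.
∏ : ∀ {n} → Vector (Rel ℕ 0ℓ) n → Rel ℕ 0ℓ
∏ = foldr _;_ _≡_

{-# OPTIONS --safe #-}

-- Let A be a recursively enumerable set that is not recursive, and let E relate 2k and 2k + 1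
-- exactly when k ∈ A. If equivalence relations Hᵢ ⊆ E generate E, then every chain from 2k to
-- 2k + 1 stays in {2k , 2k + 1}, so some Hᵢ already relates these two numbers; finitely many
-- recursive Hᵢ would thus decide A. Compositions reduce to this, since each factor of a
-- composition of equivalence relations is contained in it.
--
-- A is {k : program k returns 0 on input k}. Programs are run by a small-step machine acting on
-- binary trees, whose step function is written in a small expression language, and trees are
-- coded as numbers. Evaluation being deterministic, the machine need only reach every value a
-- program has: nothing is required of it when the program diverges.
module Submission where

open import Defs
open import Data.Empty using (⊥)
open import Data.Fin.Base using (zero; suc)
open import Data.Fin.Patterns using (0F; 1F; 2F; 3F)
open import Data.Fin.Properties using (∀-cons; sequence)
open import Data.List.Base using (List; []; _∷_)
open import Data.List.Membership.Propositional using (_∈_)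
open import Data.List.Relation.Unary.Any using (here; there)
open import Data.Nat.Base
  using (ℕ; zero; suc; pred; _+_; _*_; _∸_; _≤_; _<_; _>_; s≤s; ⌊_/2⌋; ⌈_/2⌉)
open import Data.Nat.Properties
open import Data.Product.Base using (Σ-syntax; ∃-syntax; _×_; _,_; proj₁; proj₂; map)
open import Data.Sum.Base as Sum using (_⊎_; inj₁; inj₂)
open import Data.Vec.Base using (Vec; []; _∷_)
open import Data.Vec.Functional using (Vector)
open import Data.Vec.Relation.Binary.Pointwise.Inductive using (Pointwise; []; _∷_)
open import Effect.Monad using (RawMonad)
open import Function.Base using (id; _∘_)
open import Function.Bundles using (mk⇔)
open import Level using (0ℓ)
open import Relation.Binary.Construct.Closure.ReflexiveTransitive as Star
  using (Star; ε; _◅_; _◅◅_)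
open import Relation.Binary.Construct.Closure.Transitive using ([_]; _∷_)
open import Relation.Binary.Core using (Rel; _⇒_; _⇔_)
open import Relation.Binary.Definitions using (Reflexive; tri<; tri≈; tri>)
open import Relation.Binary.PropositionalEquality
  using (_≡_; refl; sym; trans; cong; cong₂; subst)
open import Relation.Binary.Structures using (IsEquivalence)
open import Relation.Nullary.Decidable.Core using (Dec; yes; no; ¬¬-excluded-middle)
open import Relation.Nullary.Negation using (¬¬-Monad)
open import Relation.Nullary.Negation.Core using (¬_; contradiction)

private
  variable
    m n : ℕ

-- Determinism of evaluation.

mutual
  deterministic : ∀ {f : PartialRecursive n} {xs v w} → f [ xs ]↓ v → f [ xs ]↓ w → v ≡ w
  deterministic zero↓ zero↓ = refl
  deterministic suc↓ suc↓ = refl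
  deterministic (proj↓ i) (proj↓ .i) = refl
  deterministic (comp↓ ps p) (comp↓ qs q) with refl ← deterministics ps qs = deterministic p q
  deterministic (rec-zero↓ p) (rec-zero↓ q) = deterministic p q
  deterministic (rec-suc↓ p p′) (rec-suc↓ q q′) with refl ← deterministic p q = deterministic p′ q′
  deterministic (μ↓ {v = v} p p′) (μ↓ {v = w} q q′) with <-cmp v w
  ... | tri≈ _ v≡w _ = v≡w
  -- At the smaller of two distinct results, the searched function would be both zero and positive.
  ... | tri< v<w _ _ = contradiction (deterministic p′ (proj₂ (q v v<w))) 0≢1+n
  ... | tri> _ _ w<v = contradiction (sym (deterministic (proj₂ (p w w<v)) q′)) 0≢1+n

  deterministics : ∀ {gs : Vec (PartialRecursive n) m} {xs vs ws} →
                   Pointwise (λ g v → g [ xs ]↓ v) gs vs →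
                   Pointwise (λ g v → g [ xs ]↓ v) gs ws → vs ≡ ws
  deterministics [] [] = refl
  deterministics (p ∷ ps) (q ∷ qs) = cong₂ _∷_ (deterministic p q) (deterministics ps qs)

-- Programs for arithmetic.

comp₁ : PartialRecursive 1 → PartialRecursive n → PartialRecursive n
comp₁ f g = comp f (g ∷ [])

comp₂ : PartialRecursive 2 → PartialRecursive n → PartialRecursive n → PartialRecursive n
comp₂ f g h = comp f (g ∷ h ∷ [])

module _ {xs : Vec ℕ n} where

  comp₁↓ : ∀ {f g x v} → g [ xs ]↓ x → f [ x ∷ [] ]↓ v → comp₁ f g [ xs ]↓ v
  comp₁↓ p = comp↓ (p ∷ [])

  comp₂↓ : ∀ {f g h x y v} → g [ xs ]↓ x → h [ xs ]↓ y → f [ x ∷ y ∷ [] ]↓ v →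
           comp₂ f g h [ xs ]↓ v
  comp₂↓ p q = comp↓ (p ∷ q ∷ [])

addᶠ mulᶠ monusᶠ distᶠ : PartialRecursive 2
addᶠ   = rec (proj 0F) (comp₁ sucᶠ (proj 1F))
mulᶠ   = rec zeroᶠ (comp₂ addᶠ (proj 2F) (proj 1F))
monusᶠ = comp₂ (rec (proj 0F) (comp₁ (rec zeroᶠ (proj 0F)) (proj 1F))) (proj 1F) (proj 0F)
distᶠ  = comp₂ addᶠ monusᶠ (comp₂ monusᶠ (proj 1F) (proj 0F))

-- `⌊ suc k /2⌋` is `⌈ k /2⌉`, that is, `k ∸ ⌊ k /2⌋`.
halfᶠ : PartialRecursive 1
halfᶠ = rec zeroᶠ (comp₂ monusᶠ (proj 0F) (proj 1F))

dist : ℕ → ℕ → ℕ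
dist x y = (x ∸ y) + (y ∸ x)

dist-refl : ∀ x → dist x x ≡ 0
dist-refl x = cong₂ _+_ (n∸n≡0 x) (n∸n≡0 x)

dist≡0⇒≡ : ∀ x y → dist x y ≡ 0 → x ≡ y
dist≡0⇒≡ x y eq = ≤-antisym (m∸n≡0⇒m≤n (m+n≡0⇒m≡0 (x ∸ y) eq)) (m∸n≡0⇒m≤n (m+n≡0⇒n≡0 (x ∸ y) eq))

addᶠ↓ : ∀ x y → addᶠ [ x ∷ y ∷ [] ]↓ (x + y)
addᶠ↓ zero    y = rec-zero↓ (proj↓ 0F)
addᶠ↓ (suc x) y = rec-suc↓ (addᶠ↓ x y) (comp₁↓ (proj↓ 1F) suc↓)

mulᶠ↓ : ∀ x y → mulᶠ [ x ∷ y ∷ [] ]↓ (x * y)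
mulᶠ↓ zero    y = rec-zero↓ zero↓
mulᶠ↓ (suc x) y = rec-suc↓ (mulᶠ↓ x y) (comp₂↓ (proj↓ 2F) (proj↓ 1F) (addᶠ↓ y (x * y)))

monusᶠ↓ : ∀ x y → monusᶠ [ x ∷ y ∷ [] ]↓ (x ∸ y)
monusᶠ↓ x y = comp₂↓ (proj↓ 1F) (proj↓ 0F) (flipped y)
  where
  predᶠ↓ : ∀ z → rec zeroᶠ (proj 0F) [ z ∷ [] ]↓ pred z
  predᶠ↓ zero    = rec-zero↓ zero↓
  predᶠ↓ (suc z) = rec-suc↓ (predᶠ↓ z) (proj↓ 0F)

  flipped : ∀ y → rec (proj 0F) (comp₁ (rec zeroᶠ (proj 0F)) (proj 1F)) [ y ∷ x ∷ [] ]↓ (x ∸ y)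
  flipped zero    = rec-zero↓ (proj↓ 0F)
  flipped (suc y) rewrite sym (pred[m∸n]≡m∸[1+n] x y) =
    rec-suc↓ (flipped y) (comp₁↓ (proj↓ 1F) (predᶠ↓ (x ∸ y)))

distᶠ↓ : ∀ x y → distᶠ [ x ∷ y ∷ [] ]↓ dist x y
distᶠ↓ x y = comp₂↓ (monusᶠ↓ x y) (comp₂↓ (proj↓ 1F) (proj↓ 0F) (monusᶠ↓ y x)) (addᶠ↓ _ _)

halfᶠ↓ : ∀ x → halfᶠ [ x ∷ [] ]↓ ⌊ x /2⌋
halfᶠ↓ zero    = rec-zero↓ zero↓
halfᶠ↓ (suc x) =
  subst (halfᶠ [ suc x ∷ [] ]↓_)
        (trans (cong (_∸ ⌊ x /2⌋) (sym (⌊n/2⌋+⌈n/2⌉≡n x))) (m+n∸m≡n ⌊ x /2⌋ ⌈ x /2⌉))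
        (rec-suc↓ (halfᶠ↓ x) (comp₂↓ (proj↓ 0F) (proj↓ 1F) (monusᶠ↓ x ⌊ x /2⌋)))

-- Binary trees as numbers.

data Tree : Set where
  nil  : Tree
  node : Tree → Tree → Tree

left right : Tree → Tree
left  nil        = nil
left  (node a b) = a
right nil        = nil
right (node a b) = b

ifnil_then_else_ : Tree → Tree → Tree → Tree
ifnil nil      then a else b = a
ifnil node _ _ then a else b = b

-- As `encode a ≤ s`, the number `s` can be recovered as an integer root. Nodes have positive codes,
-- so testing for `nil` is testing for zero.
encode : Tree → ℕ
encode nil        = 0
encode (node a b) = suc (s * s + encode a)
  where s = encode a + encode b

nodeᶠ : PartialRecursive 2
nodeᶠ = comp₁ sucᶠ (comp₂ addᶠ (comp₂ mulᶠ addᶠ addᶠ) (proj 0F))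

rootTestᶠ : PartialRecursive 2
rootTestᶠ =
  comp₂ monusᶠ (proj 1F) (comp₂ mulᶠ (comp₁ sucᶠ (proj 0F)) (comp₁ sucᶠ (proj 0F)))

rootᶠ leftᶠ rightᶠ : PartialRecursive 1
rootᶠ  = μ rootTestᶠ
leftᶠ  = comp₂ monusᶠ (proj 0F) (comp₁ sucᶠ (comp₂ mulᶠ rootᶠ rootᶠ))
rightᶠ = comp₂ monusᶠ rootᶠ leftᶠ

nodeᶠ↓ : ∀ a b → nodeᶠ [ encode a ∷ encode b ∷ [] ]↓ encode (node a b)
nodeᶠ↓ a b =
  comp₁↓ (comp₂↓ (comp₂↓ (addᶠ↓ _ _) (addᶠ↓ _ _) (mulᶠ↓ _ _)) (proj↓ 0F) (addᶠ↓ _ _)) suc↓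

rootTestᶠ↓ : ∀ k c → rootTestᶠ [ k ∷ c ∷ [] ]↓ (c ∸ suc k * suc k)
rootTestᶠ↓ k c =
  comp₂↓ (proj↓ 1F)
    (comp₂↓ (comp₁↓ (proj↓ 0F) suc↓) (comp₁↓ (proj↓ 0F) suc↓) (mulᶠ↓ (suc k) (suc k)))
    (monusᶠ↓ _ _)

-- Writing c = s² + 1 + x with x ≤ s, the number s is the least one with c ≤ (s + 1)².
rootᶠ↓ : ∀ s x → x ≤ s → rootᶠ [ suc (s * s + x) ∷ [] ]↓ s
rootᶠ↓ s x x≤s = μ↓ below at
  where
  c = suc (s * s + x)

  at : rootTestᶠ [ s ∷ c ∷ [] ]↓ 0
  at = subst (rootTestᶠ [ s ∷ c ∷ [] ]↓_) (m≤n⇒m∸n≡0 c≤) (rootTestᶠ↓ s c)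
    where
    open ≤-Reasoning
    c≤ : c ≤ suc s * suc s
    c≤ = s≤s (begin
      s * s + x       ≤⟨ +-monoʳ-≤ (s * s) x≤s ⟩
      s * s + s       ≡⟨ +-comm (s * s) s ⟩
      s + s * s       ≡⟨ *-suc s s ⟨
      s * suc s       ≤⟨ m≤n+m _ s ⟩
      s + s * suc s   ∎)

  below : ∀ k → k < s → ∃[ w ] rootTestᶠ [ k ∷ c ∷ [] ]↓ suc w
  below k k<s = s * s + x ∸ suc k * suc k ,
    subst (rootTestᶠ [ k ∷ c ∷ [] ]↓_)
          (+-∸-assoc 1 (≤-trans (*-mono-≤ k<s k<s) (m≤m+n (s * s) x)))
          (rootTestᶠ↓ k c)

rootᶠ↓0 : rootᶠ [ 0 ∷ [] ]↓ 0
rootᶠ↓0 = μ↓ (λ k ()) (rootTestᶠ↓ 0 0)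

rootᶠ↓node : ∀ a b → rootᶠ [ encode (node a b) ∷ [] ]↓ (encode a + encode b)
rootᶠ↓node a b = rootᶠ↓ (encode a + encode b) (encode a) (m≤m+n _ _)

leftᶠ↓ : ∀ t → leftᶠ [ encode t ∷ [] ]↓ encode (left t)
leftᶠ↓ nil = comp₂↓ (proj↓ 0F) (comp₁↓ (comp₂↓ rootᶠ↓0 rootᶠ↓0 (mulᶠ↓ 0 0)) suc↓) (monusᶠ↓ 0 1)
leftᶠ↓ (node a b) =
  subst (leftᶠ [ encode (node a b) ∷ [] ]↓_) (m+n∸m≡n (s * s) (encode a))
    (comp₂↓ (proj↓ 0F) (comp₁↓ (comp₂↓ root root (mulᶠ↓ s s)) suc↓) (monusᶠ↓ _ (suc (s * s))))
  where
  s = encode a + encode b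
  root = rootᶠ↓node a b

rightᶠ↓ : ∀ t → rightᶠ [ encode t ∷ [] ]↓ encode (right t)
rightᶠ↓ nil = comp₂↓ rootᶠ↓0 (leftᶠ↓ nil) (monusᶠ↓ 0 0)
rightᶠ↓ (node a b) =
  subst (rightᶠ [ encode (node a b) ∷ [] ]↓_) (m+n∸m≡n (encode a) (encode b))
    (comp₂↓ (rootᶠ↓node a b) (leftᶠ↓ (node a b)) (monusᶠ↓ _ _))

-- In the recursion step, `proj 3F` is the second branch, behind the counter, the previous value and
-- the first branch. Both branches are evaluated, which is safe because expressions are total.
ifᶠ : PartialRecursive 3
ifᶠ = rec (proj 0F) (proj 3F)

ifᶠ↓ : ∀ t a b → ifᶠ [ encode t ∷ encode a ∷ encode b ∷ [] ]↓ encode (ifnil t then a else b)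
ifᶠ↓ nil        a b = rec-zero↓ (proj↓ 0F)
ifᶠ↓ (node c d) a b = positive _
  where
  positive : ∀ k → ifᶠ [ suc k ∷ encode a ∷ encode b ∷ [] ]↓ encode b
  positive zero    = rec-suc↓ (rec-zero↓ (proj↓ 0F)) (proj↓ 3F)
  positive (suc k) = rec-suc↓ (positive k) (proj↓ 3F)

-- A total language for single steps.

data Expr : Set where
  var nil           : Expr
  node              : Expr → Expr → Expr
  leftᵉ rightᵉ      : Expr → Expr
  ifnilᵉ_then_else_ : Expr → Expr → Expr → Expr

⟦_⟧ : Expr → Tree → Tree
⟦ var ⟧                    t = t
⟦ nil ⟧                    t = nil
⟦ node e f ⟧               t = node (⟦ e ⟧ t) (⟦ f ⟧ t)
⟦ leftᵉ e ⟧                t = left (⟦ e ⟧ t)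
⟦ rightᵉ e ⟧               t = right (⟦ e ⟧ t)
⟦ ifnilᵉ c then e else f ⟧ t = ifnil ⟦ c ⟧ t then ⟦ e ⟧ t else ⟦ f ⟧ t

compile : Expr → PartialRecursive 1
compile var                      = proj 0F
compile nil                      = zeroᶠ
compile (node e f)               = comp₂ nodeᶠ (compile e) (compile f)
compile (leftᵉ e)                = comp₁ leftᶠ (compile e)
compile (rightᵉ e)               = comp₁ rightᶠ (compile e)
compile (ifnilᵉ c then e else f) = comp ifᶠ (compile c ∷ compile e ∷ compile f ∷ [])

compile↓ : ∀ e t → compile e [ encode t ∷ [] ]↓ encode (⟦ e ⟧ t)
compile↓ var         t = proj↓ 0F
compile↓ nil         t = zero↓
compile↓ (node e f)  t = comp₂↓ (compile↓ e t) (compile↓ f t) (nodeᶠ↓ _ _)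
compile↓ (leftᵉ e)   t = comp₁↓ (compile↓ e t) (leftᶠ↓ _)
compile↓ (rightᵉ e)  t = comp₁↓ (compile↓ e t) (rightᶠ↓ _)
compile↓ (ifnilᵉ c then e else f) t =
  comp↓ (compile↓ c t ∷ compile↓ e t ∷ compile↓ f t ∷ []) (ifᶠ↓ (⟦ c ⟧ t) _ _)

-- Running a machine until it halts.

module Machine (next : Expr) where

  infix 4 _⟶_ _⟶*_

  -- Steps require a nonempty stack, so along a trace the code of the stack is positive until the
  -- final state. The search in `resultᶠ` therefore stops exactly there.
  data _⟶_ : Tree → Tree → Set where
    running : ∀ {c K x} → node (node c K) x ⟶ ⟦ next ⟧ (node (node c K) x)

  _⟶*_ : Tree → Tree → Set
  _⟶*_ = Star _⟶_

  steps : ℕ → Tree → Tree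
  steps zero    s = s
  steps (suc k) s = steps k (⟦ next ⟧ s)

  -- `steps` splits off the first step, as a trace does; the primitive recursion in `runᶠ` splits
  -- off the last.
  steps-suc : ∀ k s → steps (suc k) s ≡ ⟦ next ⟧ (steps k s)
  steps-suc zero    s = refl
  steps-suc (suc k) s = steps-suc k (⟦ next ⟧ s)

  halting-time : ∀ {s v} → s ⟶* node nil v →
                 ∃[ t ] (∀ k → k < t → ∃[ w ] encode (left (steps k s)) ≡ suc w) ×
                        steps t s ≡ node nil v
  halting-time ε = 0 , (λ k ()) , refl
  halting-time (running ◅ trace) with t , before , at ← halting-time trace =
    suc t , (λ { zero _ → _ , refl ; (suc k) (s≤s k<t) → before k k<t }) , at

  runᶠ : PartialRecursive 2
  runᶠ = rec (proj 0F) (comp₁ (compile next) (proj 1F))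

  runᶠ↓ : ∀ k s → runᶠ [ k ∷ encode s ∷ [] ]↓ encode (steps k s)
  runᶠ↓ zero    s = rec-zero↓ (proj↓ 0F)
  runᶠ↓ (suc k) s =
    subst (λ t → runᶠ [ suc k ∷ encode s ∷ [] ]↓ encode t) (sym (steps-suc k s))
      (rec-suc↓ (runᶠ↓ k s) (comp₁↓ (proj↓ 1F) (compile↓ next (steps k s))))

  resultᶠ : PartialRecursive 1
  resultᶠ = comp₁ rightᶠ (comp₂ runᶠ (μ (comp₁ leftᶠ runᶠ)) (proj 0F))

  resultᶠ↓ : ∀ {s v} → s ⟶* node nil v → resultᶠ [ encode s ∷ [] ]↓ encode v
  resultᶠ↓ {s} {v} trace with t , before , at ← halting-time trace =
    comp₁↓ (comp₂↓ (μ↓ below (final (leftᶠ↓ (node nil v)))) (proj↓ 0F) (runᶠ↓ t s))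
           (subst (λ u → rightᶠ [ encode u ∷ [] ]↓ encode v) (sym at) (rightᶠ↓ (node nil v)))
    where
    final : ∀ {w} → leftᶠ [ encode (node nil v) ∷ [] ]↓ w →
            comp₁ leftᶠ runᶠ [ t ∷ encode s ∷ [] ]↓ w
    final = comp₁↓ (subst (λ u → runᶠ [ t ∷ encode s ∷ [] ]↓ encode u) at (runᶠ↓ t s))

    below : ∀ k → k < t → ∃[ w ] comp₁ leftᶠ runᶠ [ k ∷ encode s ∷ [] ]↓ suc w
    below k k<t with w , eq ← before k k<t =
      w , comp₁↓ (runᶠ↓ k s) (subst (leftᶠ [ encode (steps k s) ∷ [] ]↓_) eq (leftᶠ↓ (steps k s)))

-- Programs as machine instructions.

numeral : ℕ → Tree
numeral zero    = nil
numeral (suc k) = node nil (numeral k)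

numeralᶠ : PartialRecursive 1
numeralᶠ = rec zeroᶠ (comp₂ nodeᶠ zeroᶠ (proj 1F))

numeralᶠ↓ : ∀ k → numeralᶠ [ k ∷ [] ]↓ encode (numeral k)
numeralᶠ↓ zero    = rec-zero↓ zero↓
numeralᶠ↓ (suc k) = rec-suc↓ (numeralᶠ↓ k) (comp₂↓ zero↓ (proj↓ 1F) (nodeᶠ↓ nil (numeral k)))

arguments : Vec ℕ n → Tree
arguments []       = nil
arguments (x ∷ xs) = node (numeral x) (arguments xs)

mutual
  -- Tag 0 serves both `zeroᶠ` and the empty list of programs, since `numeral 0` and `arguments []`
  -- are both `nil`. Tag 3 drops one argument. The `nil` in the code of `μ f` is the first candidate
  -- of the search, 0.
  code : PartialRecursive n → Tree
  code zeroᶠ          = node (numeral 0) nil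
  code sucᶠ           = node (numeral 1) nil
  code (proj zero)    = node (numeral 2) nil
  code (proj (suc i)) = node (numeral 3) (code (proj i))
  code (comp f gs)    = node (numeral 4) (node (code f) (codes gs))
  code (rec f g)      = node (numeral 8) (node (code f) (code g))
  code (μ f)          = node (numeral 10) (node (code f) nil)

  codes : Vec (PartialRecursive n) m → Tree
  codes []       = node (numeral 0) nil
  codes (g ∷ gs) = node (numeral 5) (node (code g) (codes gs))

-- The interpreter.

switch : Expr → List Expr → Expr
switch e []       = nil
switch e (f ∷ fs) = ifnilᵉ e then f else switch (rightᵉ e) fs

-- A state is node K x with K a stack of instructions and x the current argument list or value;
-- it is final when K is nil.
-- An instruction is node (numeral tag) p. The tags 6, 7, 9 and 11 are return frames: they wait,
-- respectively, for the head of a list of arguments, for its tail, for the preceding value of a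
-- primitive recursion, and for the value of f in a μ-search.
step : Expr
step = switch (leftᵉ top)
  ( state rest nil
  ∷ state rest (node nil (leftᵉ x))
  ∷ state rest (leftᵉ x)
  ∷ state (node p rest) (rightᵉ x)
  ∷ state (node (rightᵉ p) (node (leftᵉ p) rest)) x
  ∷ state (node (leftᵉ p) (node (instruction 6 (node (rightᵉ p) x)) rest)) x
  ∷ state (node (leftᵉ p) (node (instruction 7 x) rest)) (rightᵉ p)
  ∷ state rest (node p x)
  ∷ (ifnilᵉ leftᵉ x
     then state (node (leftᵉ p) rest) (rightᵉ x)
     else state (node top (node (instruction 9 (node (rightᵉ p) x′)) rest)) x′)
  ∷ state (node (leftᵉ p) rest) (node (leftᵉ (rightᵉ p)) (node x (rightᵉ (rightᵉ p))))
  ∷ state (node (leftᵉ p) (node (instruction 11 (node p x)) rest)) (node (rightᵉ p) x)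
  ∷ (ifnilᵉ x
     then state rest (rightᵉ (leftᵉ p))
     else state (node (instruction 10 (node (leftᵉ (leftᵉ p)) (node nil (rightᵉ (leftᵉ p))))) rest)
                (rightᵉ p))
  ∷ [])
  where
  state : Expr → Expr → Expr
  state = node

  top p rest x x′ : Expr
  top   = leftᵉ (leftᵉ var)
  p     = rightᵉ top
  rest  = rightᵉ (leftᵉ var)
  x     = rightᵉ var
  x′    = node (rightᵉ (leftᵉ x)) (rightᵉ x)

  instruction : ℕ → Expr → Expr
  instruction k = node (quoted k)
    where
    quoted : ℕ → Expr
    quoted zero    = nil
    quoted (suc k) = node nil (quoted k)

open Machine step

mutual
  -- Induction on the derivation. The stack `K` is arbitrary because subprograms run above pending
  -- return frames. Each `running` is one step, verified by computing `step`.
  simulate : ∀ {f : PartialRecursive n} {xs v} → f [ xs ]↓ v →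
             ∀ {K} → node (node (code f) K) (arguments xs) ⟶* node K (numeral v)
  simulate zero↓ = running ◅ ε
  simulate (suc↓ {x}) = running ◅ ε
  simulate (proj↓ {xs = x ∷ xs} zero) = running ◅ ε
  simulate (proj↓ {xs = x ∷ xs} (suc i)) = running ◅ simulate (proj↓ i)
  simulate (comp↓ ps p) = running ◅ simulates ps ◅◅ simulate p
  simulate (rec-zero↓ p) = running ◅ simulate p
  simulate (rec-suc↓ p q) = running ◅ simulate p ◅◅ running ◅ simulate q
  simulate (μ↓ {f = f} {xs = xs} {v = v} below at) {K} = search v 0 (+-identityʳ v)
    where
    -- `k` is the candidate being tested and `j` the number of failures still to come.
    search : ∀ j k → j + k ≡ v →
             node (node (node (numeral 10) (node (code f) (numeral k))) K) (arguments xs)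
               ⟶* node K (numeral v)
    search zero    k refl = running ◅ simulate at ◅◅ running ◅ ε
    search (suc j) k eq =
      running ◅ simulate (proj₂ (below k (≤-trans (s≤s (m≤n+m k j)) (≤-reflexive eq))))
              ◅◅ running ◅ search j (suc k) (trans (+-suc j k) eq)

  simulates : ∀ {gs : Vec (PartialRecursive n) m} {xs vs} →
              Pointwise (λ g v → g [ xs ]↓ v) gs vs →
              ∀ {K} → node (node (codes gs) K) (arguments xs) ⟶* node K (arguments vs)
  simulates []       = running ◅ ε
  simulates (p ∷ ps) = running ◅ simulate p ◅◅ running ◅ simulates ps ◅◅ running ◅ ε

-- Diagonalisation.

index : PartialRecursive 1 → ℕ
index f = encode (code f)

opaque

  -- The initial state has the input, read as a code, as its only instruction and the input's
  -- numeral as its only argument.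
  diagonalᶠ : PartialRecursive 1
  diagonalᶠ = comp₁ resultᶠ
    (comp₂ nodeᶠ (comp₂ nodeᶠ (proj 0F) zeroᶠ) (comp₂ nodeᶠ numeralᶠ zeroᶠ))

  -- The output is a code of `v`, not `v` itself; it is zero exactly when `v` is, which is all that
  -- acceptance depends on.
  diagonalᶠ↓ : ∀ f {v} → f [ index f ∷ [] ]↓ v →
               diagonalᶠ [ index f ∷ [] ]↓ encode (numeral v)
  diagonalᶠ↓ f p =
    comp₁↓ (comp₂↓ (comp₂↓ (proj↓ 0F) zero↓ (nodeᶠ↓ (code f) nil))
                   (comp₂↓ (numeralᶠ↓ (index f)) zero↓ (nodeᶠ↓ (numeral (index f)) nil))
                   (nodeᶠ↓ (node (code f) nil) (node (numeral (index f)) nil)))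
           (resultᶠ↓ (simulate p))

Accepted : ℕ → Set
Accepted k = diagonalᶠ [ k ∷ [] ]↓ 0

accepted : ∀ f → f [ index f ∷ [] ]↓ 0 → Accepted (index f)
accepted f = diagonalᶠ↓ f

not-accepted : ∀ f {v} → f [ index f ∷ [] ]↓ suc v → ¬ Accepted (index f)
not-accepted f p q = contradiction (deterministic q (diagonalᶠ↓ f p)) 0≢1+n

-- The relation, its enumerability and its finite classes.

E : Rel ℕ 0ℓ
E x y = x ≡ y ⊎ (⌊ x /2⌋ ≡ ⌊ y /2⌋ × Accepted ⌊ x /2⌋)

E-isEquivalence : IsEquivalence E
E-isEquivalence = record
  { refl  = inj₁ refl
  ; sym   = λ { (inj₁ refl) → inj₁ refl
              ; (inj₂ (eq , a)) → inj₂ (sym eq , subst Accepted eq a) }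
  ; trans = λ { (inj₁ refl) q → q
              ; p@(inj₂ _) (inj₁ refl) → p
              ; (inj₂ (eq , a)) (inj₂ (eq′ , _)) → inj₂ (trans eq eq′ , a) }
  }

-- The searched function ignores the candidate, so the search halts at once on input 0 and never on
-- a positive input.
zeroTestᶠ : PartialRecursive 1
zeroTestᶠ = μ (proj 1F)

zeroTestᶠ↓ : zeroTestᶠ [ 0 ∷ [] ]↓ 0
zeroTestᶠ↓ = μ↓ (λ k ()) (proj↓ 1F)

zeroTestᶠ↓⇒≡0 : ∀ {x v} → zeroTestᶠ [ x ∷ [] ]↓ v → x ≡ 0
zeroTestᶠ↓⇒≡0 (μ↓ _ p) = deterministic (proj↓ 1F) p

-- A sum vanishes only if both terms do, so one zero test checks acceptance and equality of halves.
-- The first two arguments are those of a recursion step.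
acceptedᶠ : PartialRecursive 4
acceptedᶠ = comp₁ zeroTestᶠ
  (comp₂ addᶠ (comp₁ diagonalᶠ (comp₁ halfᶠ (proj 2F)))
              (comp₂ distᶠ (comp₁ halfᶠ (proj 2F)) (comp₁ halfᶠ (proj 3F))))

acceptedᶠ↓ : ∀ k w x y → ⌊ x /2⌋ ≡ ⌊ y /2⌋ → Accepted ⌊ x /2⌋ →
             acceptedᶠ [ k ∷ w ∷ x ∷ y ∷ [] ]↓ 0
acceptedᶠ↓ k w x y eq a =
  comp₁↓ (comp₂↓ (comp₁↓ (comp₁↓ (proj↓ 2F) (halfᶠ↓ x)) a)
                 (comp₂↓ (comp₁↓ (proj↓ 2F) (halfᶠ↓ x)) (comp₁↓ (proj↓ 3F) (halfᶠ↓ y)) (distᶠ↓ _ _))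
                 (subst (addᶠ [ 0 ∷ dist ⌊ x /2⌋ ⌊ y /2⌋ ∷ [] ]↓_)
                        (trans (cong (dist ⌊ x /2⌋) (sym eq)) (dist-refl ⌊ x /2⌋))
                        (addᶠ↓ 0 _)))
         zeroTestᶠ↓

acceptedᶠ↓⇒ : ∀ {k w x y v} → acceptedᶠ [ k ∷ w ∷ x ∷ y ∷ [] ]↓ v →
              ⌊ x /2⌋ ≡ ⌊ y /2⌋ × Accepted ⌊ x /2⌋
acceptedᶠ↓⇒ {x = x} {y}
  (comp↓ (comp↓ (_∷_ {y = d} (comp↓ (half ∷ []) a) (_∷_ {y = e} b [])) sum ∷ []) test)
  with refl ← deterministic half (comp₁↓ (proj↓ 2F) (halfᶠ↓ x))
  with refl ← deterministic b
                (comp₂↓ (comp₁↓ (proj↓ 2F) (halfᶠ↓ x)) (comp₁↓ (proj↓ 3F) (halfᶠ↓ y)) (distᶠ↓ _ _))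
  with refl ← deterministic sum (addᶠ↓ d e)
  with sum≡0 ← zeroTestᶠ↓⇒≡0 test =
  dist≡0⇒≡ _ _ (m+n≡0⇒n≡0 d sum≡0) ,
  subst (diagonalᶠ [ ⌊ x /2⌋ ∷ [] ]↓_) (m+n≡0⇒m≡0 d sum≡0) a

-- The recursion is on dist x y, so that acceptedᶠ, which may diverge, is only run when x ≢ y.
E-recursivelyEnumerable : RecursivelyEnumerable E
E-recursivelyEnumerable =
  comp searchᶠ (distᶠ ∷ proj 0F ∷ proj 1F ∷ []) , λ x y → mk⇔ (to x y) (from x y)
  where
  searchᶠ : PartialRecursive 3
  searchᶠ = rec zeroᶠ acceptedᶠ

  to : ∀ x y → E x y → ∃[ v ] comp searchᶠ (distᶠ ∷ proj 0F ∷ proj 1F ∷ []) [ x ∷ y ∷ [] ]↓ v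
  to x y p = 0 , comp↓ (distᶠ↓ x y ∷ proj↓ 0F ∷ proj↓ 1F ∷ []) (search p)
    where
    search : E x y → searchᶠ [ dist x y ∷ x ∷ y ∷ [] ]↓ 0
    search (inj₁ refl) rewrite dist-refl x = rec-zero↓ zero↓
    search (inj₂ (eq , a)) = repeat (dist x y)
      where
      repeat : ∀ d → searchᶠ [ d ∷ x ∷ y ∷ [] ]↓ 0
      repeat zero    = rec-zero↓ zero↓
      repeat (suc d) = rec-suc↓ (repeat d) (acceptedᶠ↓ d 0 x y eq a)

  from : ∀ x y → (∃[ v ] comp searchᶠ (distᶠ ∷ proj 0F ∷ proj 1F ∷ []) [ x ∷ y ∷ [] ]↓ v) → E x y
  from x y (_ , comp↓ (d ∷ proj↓ _ ∷ proj↓ _ ∷ []) p) = search (deterministic (distᶠ↓ x y) d) p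
    where
    search : ∀ {d v} → dist x y ≡ d → searchᶠ [ d ∷ x ∷ y ∷ [] ]↓ v → E x y
    search eq (rec-zero↓ _)  = inj₁ (dist≡0⇒≡ x y eq)
    search _  (rec-suc↓ _ p) = inj₂ (acceptedᶠ↓⇒ p)

half-fibre : ∀ x → x ≡ ⌊ x /2⌋ + ⌊ x /2⌋ ⊎ x ≡ suc (⌊ x /2⌋ + ⌊ x /2⌋)
half-fibre zero          = inj₁ refl
half-fibre (suc zero)    = inj₂ refl
half-fibre (suc (suc x)) rewrite +-suc ⌊ x /2⌋ ⌊ x /2⌋ =
  Sum.map (cong (2 +_)) (cong (2 +_)) (half-fibre x)

E-FC : FC E
E-FC x = x ∷ h + h ∷ suc (h + h) ∷ [] , finite
  where
  h = ⌊ x /2⌋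

  finite : ∀ y → E x y → y ∈ x ∷ h + h ∷ suc (h + h) ∷ []
  finite y (inj₁ x≡y) = here (sym x≡y)
  finite y (inj₂ (eq , _)) rewrite eq = there (Sum.[ here , there ∘ here ]′ (half-fibre y))

-- Recursive generators would decide acceptance.

doubleᶠ : PartialRecursive 1
doubleᶠ = comp₂ addᶠ (proj 0F) (proj 0F)

-- Adding characteristic functions at `(2k , 2k + 1)` expresses a finite disjunction: the total is
-- positive when some relation holds there.
countᶠ : Vector (PartialRecursive 2) n → PartialRecursive 1
countᶠ {zero}  χ = zeroᶠ
countᶠ {suc n} χ =
  comp₂ addᶠ (comp₂ (χ 0F) doubleᶠ (comp₁ sucᶠ doubleᶠ)) (countᶠ (χ ∘ suc))

countᶠ-suc↓ : (χ : Vector (PartialRecursive 2) (suc n)) → ∀ {k c d} →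
              χ 0F [ k + k ∷ suc (k + k) ∷ [] ]↓ c → countᶠ (χ ∘ suc) [ k ∷ [] ]↓ d →
              countᶠ χ [ k ∷ [] ]↓ (c + d)
countᶠ-suc↓ χ p q = comp₂↓ (comp₂↓ double↓ (comp₁↓ double↓ suc↓) p) q (addᶠ↓ _ _)
  where double↓ = comp₂↓ (proj↓ 0F) (proj↓ 0F) (addᶠ↓ _ _)

Connects : Rel ℕ 0ℓ → ℕ → Set
Connects S k = S (k + k) (suc (k + k))

CountsConnecting : PartialRecursive 1 → Vector (Rel ℕ 0ℓ) n → ℕ → Set
CountsConnecting f H k =
  ((∀ i → ¬ Connects (H i) k) × f [ k ∷ [] ]↓ 0) ⊎
  ((∃[ i ] Connects (H i) k) × ∃[ v ] f [ k ∷ [] ]↓ suc v)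

-- `Recursive` yields a value only once the relation is known to hold or to fail, hence the
-- hypothesis of decisions.
countᶠ↓ : (H : Vector (Rel ℕ 0ℓ) n) (R : ∀ i → Recursive (H i)) → ∀ k →
          (∀ i → Dec (Connects (H i) k)) → CountsConnecting (countᶠ (proj₁ ∘ R)) H k
countᶠ↓ {n = zero}  H R k H? = inj₁ ((λ ()) , zero↓)
countᶠ↓ {n = suc n} H R k H? = cons (H? 0F) (countᶠ↓ (H ∘ suc) (R ∘ suc) k (H? ∘ suc))
  where
  χ     = proj₁ ∘ R
  χ-yes = proj₁ (proj₂ (R 0F) (k + k) (suc (k + k)))
  χ-no  = proj₂ (proj₂ (R 0F) (k + k) (suc (k + k)))

  cons : Dec (Connects (H 0F) k) → CountsConnecting (countᶠ (χ ∘ suc)) (H ∘ suc) k →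
         CountsConnecting (countᶠ χ) H k
  cons (yes h) (inj₁ (_ , p))           = inj₂ ((0F , h) , _ , countᶠ-suc↓ χ (χ-yes h) p)
  cons (yes h) (inj₂ (_ , _ , p))       = inj₂ ((0F , h) , _ , countᶠ-suc↓ χ (χ-yes h) p)
  cons (no ¬h) (inj₁ (¬hs , p))         = inj₁ (∀-cons ¬h ¬hs , countᶠ-suc↓ χ (χ-no ¬h) p)
  cons (no ¬h) (inj₂ ((i , h) , _ , p)) = inj₂ ((suc i , h) , _ , countᶠ-suc↓ χ (χ-no ¬h) p)

module _ (H : Vector (Rel ℕ 0ℓ) n) where

  -- Joins and compositions both embed in this closure, so one argument treats both.
  Path : Rel ℕ 0ℓ
  Path = Star (λ x y → ∃[ i ] H i x y)

  module _ (H⊆E : ∀ i → H i ⇒ E) where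

    Path⇒generator : ∀ k → Path (k + k) (suc (k + k)) → ∃[ i ] Connects (H i) k
    Path⇒generator k path = go path refl
      where
      go : ∀ {x} → Path x (suc (k + k)) → x ≡ k + k → ∃[ i ] Connects (H i) k
      go ε eq = contradiction eq 1+n≢n
      go (_◅_ {j = z} (i , h) path) refl with H⊆E i h
      ... | inj₁ refl = go path refl
      ... | inj₂ (eq , _) with half-fibre z
      -- `z` has the same half as `k + k`, namely `k`, so it is `k + k` or its successor.
      ...   | z≡ rewrite sym eq | sym (n≡⌊n+n/2⌋ k) with z≡
      ...     | inj₁ z≡2k = go path z≡2k
      ...     | inj₂ refl = i , h

    -- Apply the counting program to its own index. Value 0 makes the index accepted, so a path and
    -- hence a generator connects the pair, against the count. A positive value gives a generator
    -- inside `E`, hence acceptance, which a positive value excludes.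
    ¬recursive-generators : (∀ i → Recursive (H i)) → ¬ (E ⇒ Path)
    ¬recursive-generators R E⊆Path = ¬¬decidable (decide ∘ countᶠ↓ H R k)
      where
      f = countᶠ (proj₁ ∘ R)
      k = index f

      -- The goal is `⊥`, so excluded middle may be used for finitely many instances.
      ¬¬decidable : ¬ ¬ (∀ i → Dec (Connects (H i) k))
      ¬¬decidable = sequence (RawMonad.rawApplicative ¬¬-Monad) (λ i → ¬¬-excluded-middle)

      decide : CountsConnecting f H k → ⊥
      decide (inj₁ (¬h , p)) =
        let i , h = Path⇒generator k (E⊆Path (inj₂
                      -- `⌈ k + k /2⌉` is by definition `⌊ suc (k + k) /2⌋`.
                      ( trans (sym (n≡⌊n+n/2⌋ k)) (n≡⌈n+n/2⌉ k)
                      , subst Accepted (n≡⌊n+n/2⌋ k) (accepted f p))))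
        in ¬h i h
      decide (inj₂ ((i , h) , _ , p)) with H⊆E i h
      ... | inj₁ eq      = contradiction (sym eq) 1+n≢n
      ... | inj₂ (_ , a) = not-accepted f p (subst Accepted (sym (n≡⌊n+n/2⌋ k)) a)

-- Joins and compositions as paths.

⋁⇒Path : (H : Vector (Rel ℕ 0ℓ) n) → ⋁ H ⇒ Path H
⋁⇒Path H [ h ]   = h ◅ ε
⋁⇒Path H (h ∷ p) = h ◅ ⋁⇒Path H p

∏⇒Path : (H : Vector (Rel ℕ 0ℓ) n) → ∏ H ⇒ Path H
∏⇒Path {n = zero}  H refl        = ε
∏⇒Path {n = suc n} H (_ , h , p) = (0F , h) ◅ Star.map (map suc id) (∏⇒Path (H ∘ suc) p)

∏-refl : (H : Vector (Rel ℕ 0ℓ) n) → (∀ i → IsEquivalence (H i)) → Reflexive (∏ H)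
∏-refl {n = zero}  H eqv = refl
∏-refl {n = suc n} H eqv = _ , IsEquivalence.refl (eqv 0F) , ∏-refl (H ∘ suc) (eqv ∘ suc)

-- The other factors are crossed by reflexivity.
factor⇒∏ : (H : Vector (Rel ℕ 0ℓ) n) → (∀ i → IsEquivalence (H i)) → ∀ i → H i ⇒ ∏ H
factor⇒∏ H eqv zero    h = _ , h , ∏-refl (H ∘ suc) (eqv ∘ suc)
factor⇒∏ H eqv (suc i) h = _ , IsEquivalence.refl (eqv 0F) , factor⇒∏ (H ∘ suc) (eqv ∘ suc) i h

corollary1 : Σ[ E ∈ Rel ℕ 0ℓ ]
    IsEquivalence E × RecursivelyEnumerable E × FC E
    × ¬ (∃[ n ] n > 1 × Σ[ H ∈ Vector (Rel ℕ 0ℓ) n ]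
    (∀ i → IsEquivalence (H i) × Recursive (H i)) × (E ⇔ ⋁ H))
    × ¬ (∃[ n ] n > 1 × Σ[ H ∈ Vector (Rel ℕ 0ℓ) n ]
    (∀ i → IsEquivalence (H i) × Recursive (H i)) × (E ⇔ ∏ H))
corollary1 = E , E-isEquivalence , E-recursivelyEnumerable , E-FC , not-join , not-composition
  where
  not-join : ¬ (∃[ n ] n > 1 × Σ[ H ∈ Vector (Rel ℕ 0ℓ) n ]
               (∀ i → IsEquivalence (H i) × Recursive (H i)) × (E ⇔ ⋁ H))
  not-join (_ , _ , H , dec , E⇒⋁ , ⋁⇒E) =
    ¬recursive-generators H (λ i h → ⋁⇒E [ i , h ]) (proj₂ ∘ dec) (⋁⇒Path H ∘ E⇒⋁)

  not-composition : ¬ (∃[ n ] n > 1 × Σ[ H ∈ Vector (Rel ℕ 0ℓ) n ]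
                      (∀ i → IsEquivalence (H i) × Recursive (H i)) × (E ⇔ ∏ H))
  not-composition (_ , _ , H , dec , E⇒∏ , ∏⇒E) =
    ¬recursive-generators H (λ i h → ∏⇒E (factor⇒∏ H (proj₁ ∘ dec) i h)) (proj₂ ∘ dec)
                          (∏⇒Path H ∘ E⇒∏)
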